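{- Let $0 < \varepsilon \le \frac{1}{10}$ and $0 < \beta \le \frac{\varepsilon}{9}$. The algorithm $\mathcal{ALG}^\varepsilon_{PS}$, with first output $\mathcal{ALG}_1(S) = W'_S$ and second output $\mathcal{ALG}_2(S) = w(\hat{M}(S))$, is an $\bigl(\mathsf{MWM}, 2+2\varepsilon, 3+20\varepsilon, \beta\bigr)$-refined lookahead algorithm. That is, for every stream $S$ of weighted edges, $W'_S \le \mathsf{MWM}(S) \le (2+2\varepsilon) W'_S$, and for every partition $S = ABC$ into consecutive substreams with $W'_B \ge (1-\beta) W'_{AB}$, we have $w(\hat{M}(BC)) \le \mathsf{MWM}(ABC) \le (3+20\varepsilon)\cdot w(\hat{M}(BC))$.
   Context: A stream is a sequence of edges on a vertex set $V$, each edge $e$ with weight $w(e)>0$; $AB$, $ABC$ denote concatenations of streams; $w(F)=\sum_{e\in F} w(e)$ and $\mathsf{MWM}(S)$ is the maximum weight of a matching in the graph formed by the edges of $S$. Algorithm $\mathcal{ALG}^\varepsilon_{PS}$ on a stream $S$: initialize an empty stack and potentials $\varphi(v) = 0$ for all $v\in V$. When edge $e=\{u,v\}$ arrives: if $w(e) < (1+\varepsilon)(\varphi(u)+\varphi(v))$, set $w'(e)=0$; otherwise set $w'(e) = w(e) - (\varphi(u)+\varphi(v))$, increase both $\varphi(u)$ and $\varphi(v)$ by $w'(e)$, and push $e$ on the stack. Then, for each $x\in\{u,v\}$, if $x$ is incident to more than $\frac{3\log(1/\varepsilon)}{\varepsilon}+1$ edges in the stack, remove the oldest stack edge incident to $x$.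 After the stream ends, pop the stack edges one by one, adding each popped edge to an initially empty matching $\hat{M}$ whenever $\hat{M}$ stays a matching; $\hat{M}(S)$ is the result. $w'_S(e)$ denotes the value $w'(e)$ (reduced weight) computed in the run on $S$, and $W'_S = \sum_{e\in S} w'_S(e)$. An $(f,\alpha_1,\alpha_2,\beta)$-refined lookahead algorithm is a streaming algorithm with two outputs $\mathcal{ALG}_1,\mathcal{ALG}_2$ such that for every stream $S$: (1) $\mathcal{ALG}_1(S)\le f(S)\le \alpha_1 \mathcal{ALG}_1(S)$, and (2) for every partition $S=ABC$ with $\mathcal{ALG}_1(B)\ge(1-\beta)\mathcal{ALG}_1(AB)$, $\mathcal{ALG}_2(BC)\le f(ABC)\le\alpha_2\mathcal{ALG}_2(BC)$.
   Formalization: The edge weights and the parameters ε and β are taken to be rational numbers rather than real numbers; the logarithm in the stack threshold is read as base 2. -}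

module Defs where

open import Data.Bool using (Bool; true; false; if_then_else_; _∨_)
open import Data.Nat as ℕ using (ℕ; zero; suc; _∸_; _^_)
import Data.Nat.Properties as ℕP
open import Data.Integer using (ℤ; +_; ∣_∣)
open import Data.Rational using (ℚ; 0ℚ; 1ℚ; _+_; _-_; _*_; _<_; _≤_; _/_; ↥_; ↧ₙ_)
open import Data.Rational.Properties using (_<?_)
open import Data.List using (List; []; _∷_; reverse; length; filter)
open import Data.List.Relation.Unary.All using (All)
open import Data.List.Relation.Unary.AllPairs using (AllPairs)
open import Data.List.Relation.Binary.Sublist.Propositional using (_⊆_)
open import Data.Product using (_×_; ∃-syntax; _,_)
open import Relation.Binary.PropositionalEquality using (_≡_; _≢_)
open import Relation.Nullary using (Dec; yes; no; does; ¬_)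
open import Relation.Nullary.Decidable using (_×-dec_; ¬?)

record Edge : Set where
  constructor edge
  field
    u : ℕ
    v : ℕ
    w : ℚ
open Edge public

ValidStream : List Edge → Set
ValidStream S = All (λ e → (u e ≢ v e) × (0ℚ < w e)) S

weight : List Edge → ℚ
weight []      = 0ℚ
weight (e ∷ F) = w e + weight F

Disjoint : Edge → Edge → Set
Disjoint e f = (u e ≢ u f) × (u e ≢ v f) × (v e ≢ u f) × (v e ≢ v f)

disjoint? : (e f : Edge) → Dec (Disjoint e f)
disjoint? e f = ¬? (u e ℕ.≟ u f) ×-dec ¬? (u e ℕ.≟ v f)
              ×-dec ¬? (v e ℕ.≟ u f) ×-dec ¬? (v e ℕ.≟ v f)

IsMatchingIn : List Edge → List Edge → Set
IsMatchingIn S M = (M ⊆ S) × AllPairs Disjoint M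

infix 4 _≤MWM_ MWM_≤_

_≤MWM_ : ℚ → List Edge → Set
x ≤MWM S = ∃[ M ] (IsMatchingIn S M × x ≤ weight M)

MWM_≤_ : List Edge → ℚ → Set
MWM S ≤ y = ∀ M → IsMatchingIn S M → weight M ≤ y

-- c > 3·log₂(1/ε)/ε + 1, decided exactly.  With ε = p/q (p,q > 0, ε < 1):
--   c > 3 (q/p) log₂(q/p) + 1  ⇔  2^(p(c-1)/(3q)) > q/p
--                              ⇔  2^(p(c-1)) · p^(3q) > q^(3q)     (c ≥ 1)
-- and for c = 0 the condition is false (the threshold is positive).
exceedsBound : ℚ → ℕ → Bool
exceedsBound ε zero    = false
exceedsBound ε (suc c) =
  does ((q ^ (3 ℕ.* q)) ℕ.<? (2 ^ (p ℕ.* c)) ℕ.* (p ^ (3 ℕ.* q)))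
  where
    p = ∣ ↥ ε ∣
    q = ↧ₙ ε

incident : ℕ → Edge → Bool
incident x e = does (u e ℕ.≟ x) ∨ does (v e ℕ.≟ x)

-- the stack is a list, newest edge first
count : ℕ → List Edge → ℕ
count x []       = 0
count x (e ∷ st) = if incident x e then suc (count x st) else count x st

removeFirst : ℕ → List Edge → List Edge
removeFirst x []       = []
removeFirst x (e ∷ st) = if incident x e then st else e ∷ removeFirst x st

removeOldest : ℕ → List Edge → List Edge
removeOldest x st = reverse (removeFirst x (reverse st))

trim : ℚ → ℕ → List Edge → List Edge
trim ε x st = if exceedsBound ε (count x st) then removeOldest x st else st

record AlgState : Set where
  constructor mkState
  field
    stack : List Edge
    φ     : ℕ → ℚ
    W'    : ℚ
open AlgState public

update : (ℕ → ℚ) → ℕ → ℚ → (ℕ → ℚ)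
update φ x d y = if does (y ℕ.≟ x) then φ y + d else φ y

step : ℚ → AlgState → Edge → AlgState
step ε (mkState s φ W) e =
  if does (w e <? (1ℚ + ε) * (φ (u e) + φ (v e)))
  then mkState (trim ε (v e) (trim ε (u e) s)) φ W
  else mkState (trim ε (v e) (trim ε (u e) (e ∷ s)))
          (update (update φ (u e) w') (v e) w')
          (W + w')
  where
    w' = w e - (φ (u e) + φ (v e))

initState : AlgState
initState = mkState [] (λ _ → 0ℚ) 0ℚ

run : ℚ → AlgState → List Edge → AlgState
run ε σ []      = σ
run ε σ (e ∷ S) = run ε (step ε σ e) S

W'[_] : ℚ → List Edge → ℚ
W'[ ε ] S = W' (run ε initState S)

unwind : List Edge → List Edge → List Edge
unwind M []       = M
unwind M (e ∷ st) =
  if does (Data.List.Relation.Unary.All.all? (disjoint? e) M)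
  then unwind (e ∷ M) st
  else unwind M st

M̂[_] : ℚ → List Edge → List Edge
M̂[ ε ] S = unwind [] (stack (run ε initState S))

{-# OPTIONS --safe #-}
module Submission where

-- An accepted edge e has w(e) = w'(e) + φ(u) + φ(v), with the potentials taken just before e.  Unwinding the stack from
-- any matching M therefore yields a matching of weight at least w(M) + W' − φ(V(M)); M = ∅ gives W' ≤ MWM.  Conversely
-- every edge satisfies w(e) ≤ (1+ε)(φ(u) + φ(v)) and the potentials sum to 2W', so MWM ≤ (2+2ε)W'.
--
-- For ABC, split an optimal matching into O₁ in A and O₂ in BC.  Unwinding the stack of B from O₁ gives a matching of
-- AB, so w(O₁) + W'_B − φ_B(V(O₁)) ≤ (2+2ε)W'_AB ≤ (2+3ε)W'_B.  Adding w(O₂) ≤ (1+ε)φ_BC(V(O₂)) and φ_B ≤ φ_BC gives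
-- w(O₁ ∪ O₂) ≤ (3+5ε)W'_BC.
--
-- Evicting e at x when f is pushed costs at most w'(e) in the unwinding bound.  Each newer stack edge at x multiplied
-- φ(x) by at least 1+ε, so w'(e)·(1+ε)^k ≤ φ(x) ≤ (1+1/ε)w'(f), while the threshold makes (1+ε)^k ≥ ε⁻³.  Hence
-- w'(e) ≤ ε·w'(f), and since f causes at most two evictions, w(M̂) ≥ (1−2ε)W'.

open import Relation.Binary.PropositionalEquality using (_≡_; _≢_; refl; sym; trans; cong; cong₂; subst; subst₂; module ≡-Reasoning)

-- Integer inequalities behind the stack-size threshold.

module Growth where

  open import Data.Nat
  open import Data.Nat.Properties
  open import Data.Nat.Solver using (module +-*-Solver)
  open +-*-Solver using (solve; _:=_; con; _:+_; _:*_)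
  open ≤-Reasoning

  ^-distribʳ-* : ∀ m n o → (m * n) ^ o ≡ m ^ o * n ^ o
  ^-distribʳ-* m n zero    = refl
  ^-distribʳ-* m n (suc o) = trans (cong (m * n *_) (^-distribʳ-* m n o))
    (solve 4 (λ a b c d → a :* b :* (c :* d) := a :* c :* (b :* d)) refl
      m n (m ^ o) (n ^ o))

  -- Bernoulli's inequality (1 - x)^n ≥ 1 - nx at x = d/(a + d), multiplied by (a + d)^(n+1) and
  -- rearranged to avoid subtraction.
  bernoulli : ∀ a d n → (a + d) ^ n * (a + d) ≤ a ^ n * (a + d) + n * d * (a + d) ^ n
  bernoulli a d zero    = m≤m+n _ _
  bernoulli a d (suc n) = begin
    b * bⁿ * b                                         ≡⟨ *-assoc b bⁿ b ⟩
    b * (bⁿ * b)                                       ≤⟨ *-monoʳ-≤ b (bernoulli a d n) ⟩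
    b * (aⁿ * b + n * d * bⁿ)                          ≡⟨ expand ⟩
    a * aⁿ * b + (d * (aⁿ * b) + n * d * (b * bⁿ))
      ≤⟨ +-monoʳ-≤ (a * aⁿ * b) (+-monoˡ-≤ (n * d * (b * bⁿ)) (*-monoʳ-≤ d (*-monoˡ-≤ b (^-monoˡ-≤ n (m≤m+n a d))))) ⟩
    a * aⁿ * b + (d * (bⁿ * b) + n * d * (b * bⁿ))     ≡⟨ collect ⟩
    a * aⁿ * b + suc n * d * (b * bⁿ)                  ∎
    where
    b  = a + d
    aⁿ = a ^ n
    bⁿ = b ^ n
    expand = solve 5 (λ a d n x y → (a :+ d) :* (x :* (a :+ d) :+ n :* d :* y)
               := a :* x :* (a :+ d) :+ (d :* (x :* (a :+ d)) :+ n :* d :* ((a :+ d) :* y))) refl a d n aⁿ bⁿ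
    collect = solve 5 (λ b d n y z → z :+ (d :* (y :* b) :+ n :* d :* (b :* y))
               := z :+ (con 1 :+ n) :* d :* (b :* y)) refl b d n bⁿ (a * aⁿ * b)

  -- (1 + p/q)^q increases with q, with denominators cleared.
  compound-step : ∀ p q .{{_ : NonZero q}} →
    suc q ^ suc q * (q + p) ^ q ≤ (suc q + p) ^ suc q * q ^ q
  compound-step p q@(suc _) = *-cancelʳ-≤ _ _ (n * (q * (q + p))) (begin
    n ^ n * (q + p) ^ q * (n * (q * (q + p)))
      ≡⟨ solve 5 (λ x y n q s → x :* y :* (n :* (q :* s)) := (x :* (s :* y)) :* (n :* q)) refl (n ^ n) ((q + p) ^ q) n q (q + p) ⟩
    n ^ n * (q + p) ^ n * (n * q)
      ≡⟨ cong (_* (n * q)) (sym (^-distribʳ-* n (q + p) n)) ⟩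
    (n * (q + p)) ^ n * (n * q)
      ≤⟨ +-cancelʳ-≤ _ _ _ shifted ⟩
    (m * q) ^ n * (n * (q + p))
      ≡⟨ cong (_* (n * (q + p))) (^-distribʳ-* m q n) ⟩
    m ^ n * q ^ n * (n * (q + p))
      ≡⟨ solve 5 (λ x y n q s → x :* (q :* y) :* (n :* s) := x :* y :* (n :* (q :* s))) refl (m ^ n) (q ^ q) n q (q + p) ⟩
    m ^ n * q ^ q * (n * (q * (q + p))) ∎)
    where
    n = suc q
    m = suc q + p
    b = n * (q + p)
    -- `bernoulli` is used with base `m * q` and increment `p`: since mq + p = n(q + p), x = p/b and
    -- 1 - nx is exactly q/(q + p), the ratio required once the cancelled factors are put in.
    b≡ : m * q + p ≡ b
    b≡ = solve 2 (λ p q → (con 1 :+ q :+ p) :* q :+ p := (con 1 :+ q) :* (q :+ p)) refl p q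
    shifted : b ^ n * (n * q) + b ^ n * (n * p) ≤ (m * q) ^ n * b + b ^ n * (n * p)
    shifted = begin
      b ^ n * (n * q) + b ^ n * (n * p)
        ≡⟨ solve 4 (λ x n q p → x :* (n :* q) :+ x :* (n :* p) := x :* (n :* (q :+ p))) refl (b ^ n) n q p ⟩
      b ^ n * b
        ≤⟨ subst (λ c → c ^ n * c ≤ (m * q) ^ n * c + n * p * c ^ n) b≡ (bernoulli (m * q) p n) ⟩
      (m * q) ^ n * b + n * p * b ^ n
        ≡⟨ cong (((m * q) ^ n * b) +_) (*-comm (n * p) (b ^ n)) ⟩
      (m * q) ^ n * b + b ^ n * (n * p) ∎

  -- 2^x ≤ 1 + x for x = p/q ∈ [0,1], q = r + p, with denominators cleared.
  2^p*q^q≤[q+p]^q : ∀ p r → 2 ^ p * (r + p) ^ (r + p) ≤ (r + p + p) ^ (r + p)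
  -- The induction starts at q = p, where both sides are (2p)^p; `compound-step` then raises q by
  -- one.
  2^p*q^q≤[q+p]^q p zero = ≤-reflexive (trans (sym (^-distribʳ-* 2 p p))
    (cong (_^ p) (cong (p +_) (+-identityʳ p))))
  -- Set apart because `compound-step` needs r + p to be nonzero.
  2^p*q^q≤[q+p]^q zero (suc r) = ≤-reflexive (trans (+-identityʳ _) (cong (_^ (suc r + 0)) (sym (+-identityʳ (suc r + 0)))))
  2^p*q^q≤[q+p]^q p@(suc p-1) (suc r) = *-cancelʳ-≤ _ _ (q ^ q) {{m^n≢0 q q {{q≢0}}}} (begin
    2 ^ p * suc q ^ suc q * q ^ q
      ≡⟨ solve 3 (λ x y z → x :* y :* z := y :* (x :* z)) refl (2 ^ p) (suc q ^ suc q) (q ^ q) ⟩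
    suc q ^ suc q * (2 ^ p * q ^ q)
      ≤⟨ *-monoʳ-≤ (suc q ^ suc q) (2^p*q^q≤[q+p]^q p r) ⟩
    suc q ^ suc q * (q + p) ^ q
      ≤⟨ compound-step p q {{q≢0}} ⟩
    (suc q + p) ^ suc q * q ^ q ∎)
    where
    q = r + p
    q≢0 : NonZero q
    q≢0 = >-nonZero (≤-trans (s≤s z≤n) (m≤n+m p r))

  -- With ε = p/q the claim is (1 + ε)^k ≥ ε⁻³. Comparing q-th powers avoids roots: the hypothesis
  -- bounds ε⁻³ by 2^(εk), and `2^p*q^q≤[q+p]^q` is 2^ε ≤ 1 + ε, which requires ε ≤ 1.
  threshold-growth : ∀ p q k .{{_ : NonZero q}} → p ≤ q →
    q ^ (3 * q) < 2 ^ (p * k) * p ^ (3 * q) →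
    q ^ 3 * q ^ k ≤ (q + p) ^ k * p ^ 3
  threshold-growth p q k p≤q exceeds = ≮⇒≥ λ small → <-irrefl refl (begin-strict
    ((q + p) ^ k * p ^ 3) ^ q       <⟨ ^-monoˡ-< q small ⟩
    (q ^ 3 * q ^ k) ^ q             ≡⟨ trans (^-distribʳ-* (q ^ 3) (q ^ k) q) (cong₂ _*_ (^-*-assoc q 3 q) (^-*-assoc q k q)) ⟩
    q ^ (3 * q) * q ^ (k * q)       ≤⟨ *-monoˡ-≤ (q ^ (k * q)) (<⇒≤ exceeds) ⟩
    2 ^ (p * k) * p ^ (3 * q) * q ^ (k * q)
      ≡⟨ solve 3 (λ x y z → x :* y :* z := x :* z :* y) refl (2 ^ (p * k)) (p ^ (3 * q)) (q ^ (k * q)) ⟩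
    2 ^ (p * k) * q ^ (k * q) * p ^ (3 * q)
      ≡⟨ cong (λ x → 2 ^ (p * k) * q ^ x * p ^ (3 * q)) (*-comm k q) ⟩
    2 ^ (p * k) * q ^ (q * k) * p ^ (3 * q)
      ≡⟨ cong (_* (p ^ (3 * q))) (trans (cong₂ _*_ (sym (^-*-assoc 2 p k)) (sym (^-*-assoc q q k))) (sym (^-distribʳ-* (2 ^ p) (q ^ q) k))) ⟩
    (2 ^ p * q ^ q) ^ k * p ^ (3 * q)
      ≤⟨ *-monoˡ-≤ (p ^ (3 * q)) (^-monoˡ-≤ k doubling) ⟩
    ((q + p) ^ q) ^ k * p ^ (3 * q)
      ≡⟨ cong (_* (p ^ (3 * q))) (trans (^-*-assoc (q + p) q k) (trans (cong ((q + p) ^_) (*-comm q k)) (sym (^-*-assoc (q + p) k q)))) ⟩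
    ((q + p) ^ k) ^ q * p ^ (3 * q)
      ≡⟨ cong (((q + p) ^ k) ^ q *_) (sym (^-*-assoc p 3 q)) ⟩
    ((q + p) ^ k) ^ q * (p ^ 3) ^ q
      ≡⟨ sym (^-distribʳ-* ((q + p) ^ k) (p ^ 3) q) ⟩
    ((q + p) ^ k * p ^ 3) ^ q ∎)
    where
    doubling : 2 ^ p * q ^ q ≤ (q + p) ^ q
    doubling = subst (λ n → 2 ^ p * n ^ n ≤ (n + p) ^ n) (m∸n+n≡m p≤q) (2^p*q^q≤[q+p]^q p (q ∸ p))

open import Defs
open import Algebra.Bundles using (CommutativeRing)
open import Data.Bool using (Bool; true; false; if_then_else_; _∨_)
open import Data.Empty using (⊥-elim)
open import Data.Integer as ℤ using (+_; -[1+_]; ∣_∣)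
import Data.Integer.Properties as ℤP
open import Data.List using (List; []; _∷_; _++_; _ʳ++_; reverse; [_])
import Data.List.Properties as List
open import Data.List.Membership.Propositional using (_∈_; _∉_)
open import Data.List.Relation.Binary.Permutation.Propositional using (↭-sym)
open import Data.List.Relation.Binary.Permutation.Propositional.Properties using (All-resp-↭; ↭-reverse)
open import Data.List.Relation.Binary.Sublist.Propositional using (_⊆_; []; _∷_; _∷ʳ_; ⊆-refl; ⊆-trans)
open import Data.List.Relation.Binary.Sublist.Propositional.Properties using (All-resp-⊆; ʳ++⁺; ++⁺ˡ; reverse⁺)
open import Data.List.Relation.Unary.All as All using (All; []; _∷_)
import Data.List.Relation.Unary.All.Properties as AllP
open import Data.List.Relation.Unary.AllPairs using (AllPairs; []; _∷_)
open import Data.List.Relation.Unary.Any using (here; there)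
open import Data.List.Relation.Unary.Unique.Propositional using (Unique)
open import Data.Nat as ℕ using (ℕ; zero; suc; z≤n; s≤s)
open import Data.List.Membership.DecPropositional ℕ._≟_ using (_∈?_)
import Data.Nat.Properties as ℕP
open import Data.Product using (_×_; _,_; ∃-syntax; proj₁; proj₂)
open import Data.Rational using (ℚ; 0ℚ; 1ℚ; _+_; _-_; _*_; -_; _<_; _≤_; _/_; ↥_; ↧ₙ_; mkℚ; *≤*; *<*; toℚᵘ; positive; nonNegative)
open import Data.Rational.Properties
open import Data.Rational.Solver using (module +-*-Solver)
import Data.Rational.Unnormalised as ℚᵘ
import Data.Rational.Unnormalised.Properties as ℚᵘP
open import Data.Sum using (_⊎_; inj₁; inj₂)
open import Algebra.Properties.CommutativeSemiring.Exp (CommutativeRing.commutativeSemiring +-*-commutativeRing) using (_^_; ^-distrib-*)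
open import Function using (_∘_)
open import Relation.Nullary using (Dec; yes; no; does; ¬_)
open import Relation.Nullary.Decidable using (dec-true; dec-false)
open +-*-Solver using (solve; _:=_; con; _:+_; _:*_; _:-_)

-- Order arithmetic on the rationals and the embedding of the naturals.

0≤+ : ∀ {x y} → 0ℚ ≤ x → 0ℚ ≤ y → 0ℚ ≤ x + y
0≤+ = +-mono-≤

0≤* : ∀ {x y} → 0ℚ ≤ x → 0ℚ ≤ y → 0ℚ ≤ x * y
0≤* {x} {y} 0≤x 0≤y = subst (_≤ x * y) (*-zeroʳ x) (*-monoˡ-≤-nonNeg x {{nonNegative 0≤x}} 0≤y)

0≤- : ∀ {x y} → x ≤ y → 0ℚ ≤ y - x
0≤- {x} {y} x≤y = subst (_≤ y - x) (+-inverseʳ x) (+-monoˡ-≤ (- x) x≤y)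

≤-from-slack : ∀ {x y} s → y ≡ x + s → 0ℚ ≤ s → x ≤ y
≤-from-slack {x} s refl 0≤s = subst (_≤ x + s) (+-identityʳ x) (+-monoʳ-≤ x 0≤s)

fromℕ : ℕ → ℚ
fromℕ n = + n / 1

toℚᵘ-fromℕ : ∀ n → toℚᵘ (fromℕ n) ℚᵘ.≃ ℚᵘ.mkℚᵘ (+ n) 0
toℚᵘ-fromℕ n = toℚᵘ-fromℚᵘ (ℚᵘ.mkℚᵘ (+ n) 0)

fromℕ-homo-+ : ∀ m n → fromℕ (m ℕ.+ n) ≡ fromℕ m + fromℕ n
fromℕ-homo-+ m n = toℚᵘ-injective (begin
  toℚᵘ (fromℕ (m ℕ.+ n))                          ≈⟨ toℚᵘ-fromℕ (m ℕ.+ n) ⟩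
  ℚᵘ.mkℚᵘ (+ (m ℕ.+ n)) 0                         ≈⟨ ℚᵘ.*≡* (cong (ℤ._* + 1) (sym (cong₂ ℤ._+_ (ℤP.*-identityʳ (+ m)) (ℤP.*-identityʳ (+ n))))) ⟩
  ℚᵘ.mkℚᵘ (+ m) 0 ℚᵘ.+ ℚᵘ.mkℚᵘ (+ n) 0            ≈⟨ ℚᵘP.+-cong (toℚᵘ-fromℕ m) (toℚᵘ-fromℕ n) ⟨
  toℚᵘ (fromℕ m) ℚᵘ.+ toℚᵘ (fromℕ n)              ≈⟨ toℚᵘ-homo-+ (fromℕ m) (fromℕ n) ⟨
  toℚᵘ (fromℕ m + fromℕ n)                        ∎)
  where open import Relation.Binary.Reasoning.Setoid ℚᵘP.≃-setoid

fromℕ-homo-* : ∀ m n → fromℕ (m ℕ.* n) ≡ fromℕ m * fromℕ n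
fromℕ-homo-* m n = toℚᵘ-injective (begin
  toℚᵘ (fromℕ (m ℕ.* n))                          ≈⟨ toℚᵘ-fromℕ (m ℕ.* n) ⟩
  ℚᵘ.mkℚᵘ (+ (m ℕ.* n)) 0                         ≈⟨ ℚᵘ.*≡* (cong (ℤ._* + 1) (ℤP.pos-* m n)) ⟩
  ℚᵘ.mkℚᵘ (+ m) 0 ℚᵘ.* ℚᵘ.mkℚᵘ (+ n) 0            ≈⟨ ℚᵘP.*-cong (toℚᵘ-fromℕ m) (toℚᵘ-fromℕ n) ⟨
  toℚᵘ (fromℕ m) ℚᵘ.* toℚᵘ (fromℕ n)              ≈⟨ toℚᵘ-homo-* (fromℕ m) (fromℕ n) ⟨
  toℚᵘ (fromℕ m * fromℕ n)                        ∎)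
  where open import Relation.Binary.Reasoning.Setoid ℚᵘP.≃-setoid

fromℕ-homo-^ : ∀ m n → fromℕ (m ℕ.^ n) ≡ fromℕ m ^ n
fromℕ-homo-^ m zero    = refl
fromℕ-homo-^ m (suc n) = trans (fromℕ-homo-* m (m ℕ.^ n)) (cong (fromℕ m *_) (fromℕ-homo-^ m n))

fromℕ-mono-≤ : ∀ {m n} → m ℕ.≤ n → fromℕ m ≤ fromℕ n
fromℕ-mono-≤ {m} {n} m≤n = toℚᵘ-cancel-≤ (begin
  toℚᵘ (fromℕ m)      ≃⟨ toℚᵘ-fromℕ m ⟩
  ℚᵘ.mkℚᵘ (+ m) 0     ≤⟨ ℚᵘ.*≤* (ℤP.*-monoʳ-≤-nonNeg (+ 1) (ℤ.+≤+ m≤n)) ⟩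
  ℚᵘ.mkℚᵘ (+ n) 0     ≃⟨ toℚᵘ-fromℕ n ⟨
  toℚᵘ (fromℕ n)      ∎)
  where open ℚᵘP.≤-Reasoning

numerator-≡ : ∀ ε → 0ℚ < ε → ε * fromℕ (↧ₙ ε) ≡ fromℕ ∣ ↥ ε ∣
numerator-≡ ε@(mkℚ (+ p) q-1 _) _ = toℚᵘ-injective (begin
  toℚᵘ (ε * fromℕ q)                      ≈⟨ toℚᵘ-homo-* ε (fromℕ q) ⟩
  toℚᵘ ε ℚᵘ.* toℚᵘ (fromℕ q)              ≈⟨ ℚᵘP.*-congˡ {toℚᵘ ε} (toℚᵘ-fromℕ q) ⟩
  toℚᵘ ε ℚᵘ.* ℚᵘ.mkℚᵘ (+ q) 0             ≈⟨ ℚᵘ.*≡* (trans (ℤP.*-identityʳ _) (cong (λ n → + p ℤ.* + n) (sym (ℕP.*-identityʳ q)))) ⟩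
  ℚᵘ.mkℚᵘ (+ p) 0                         ≈⟨ toℚᵘ-fromℕ p ⟨
  toℚᵘ (fromℕ p)                          ∎)
  where
  open import Relation.Binary.Reasoning.Setoid ℚᵘP.≃-setoid
  q = suc q-1
numerator-≡ (mkℚ -[1+ _ ] _ _) (*<* ())

fromℕ-pos : ∀ n .{{_ : ℕ.NonZero n}} → 0ℚ < fromℕ n
fromℕ-pos n = <-≤-trans (positive⁻¹ 1ℚ) (fromℕ-mono-≤ (ℕ.>-nonZero⁻¹ n))

numerator-≤-denominator : ∀ ε → 0ℚ < ε → ε ≤ 1ℚ → ∣ ↥ ε ∣ ℕ.≤ ↧ₙ ε
numerator-≤-denominator (mkℚ (+ p) q-1 _) _ (*≤* le) = ℤP.drop‿+≤+ (subst₂ ℤ._≤_ (ℤP.*-identityʳ (+ p)) (ℤP.*-identityˡ (+ suc q-1)) le)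
numerator-≤-denominator (mkℚ -[1+ _ ] _ _) (*<* ()) _

does-true : ∀ {P : Set} (P? : Dec P) → does P? ≡ true → P
does-true (yes p) _ = p

does-false : ∀ {P : Set} (P? : Dec P) → does P? ≡ false → ¬ P
does-false (no ¬p) _ = ¬p

-- This is `threshold-growth` divided by q^(3 + k). The exponent is one below the count, by the +1
-- in the threshold; it is the number of edges at the vertex other than the oldest.
exceedsBound-growth : ∀ ε k → 0ℚ < ε → ε ≤ 1ℚ → exceedsBound ε (suc k) ≡ true →
  1ℚ ≤ (1ℚ + ε) ^ k * (ε * (ε * ε))
exceedsBound-growth ε k 0<ε ε≤1 exceeds =
  *-cancelʳ-≤-pos (Q ^ 3 * Q ^ k) {{positive (subst (0ℚ <_) (trans (fromℕ-homo-* (q ℕ.^ 3) (q ℕ.^ k)) (cong₂ _*_ (fromℕ-homo-^ q 3) (fromℕ-homo-^ q k)))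
      (fromℕ-pos (q ℕ.^ 3 ℕ.* q ℕ.^ k) {{ℕP.m*n≢0 (q ℕ.^ 3) (q ℕ.^ k) {{ℕP.m^n≢0 q 3}} {{ℕP.m^n≢0 q k}}}}))}} (begin
  1ℚ * (Q ^ 3 * Q ^ k)                               ≡⟨ *-identityˡ _ ⟩
  Q ^ 3 * Q ^ k                                      ≡⟨ cong₂ _*_ (fromℕ-homo-^ q 3) (fromℕ-homo-^ q k) ⟨
  fromℕ (q ℕ.^ 3) * fromℕ (q ℕ.^ k)                  ≡⟨ fromℕ-homo-* (q ℕ.^ 3) (q ℕ.^ k) ⟨
  fromℕ (q ℕ.^ 3 ℕ.* q ℕ.^ k)                        ≤⟨ fromℕ-mono-≤ (Growth.threshold-growth p q k (numerator-≤-denominator ε 0<ε ε≤1) (does-true (_ ℕ.<? _) exceeds)) ⟩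
  fromℕ ((q ℕ.+ p) ℕ.^ k ℕ.* p ℕ.^ 3)                ≡⟨ fromℕ-homo-* ((q ℕ.+ p) ℕ.^ k) (p ℕ.^ 3) ⟩
  fromℕ ((q ℕ.+ p) ℕ.^ k) * fromℕ (p ℕ.^ 3)          ≡⟨ cong₂ _*_ (fromℕ-homo-^ (q ℕ.+ p) k) (fromℕ-homo-^ p 3) ⟩
  fromℕ (q ℕ.+ p) ^ k * fromℕ p ^ 3                  ≡⟨ cong₂ (λ x y → x ^ k * y ^ 3) (fromℕ-homo-+ q p) (sym εQ) ⟩
  (Q + fromℕ p) ^ k * (ε * Q) ^ 3                    ≡⟨ cong (λ x → (Q + x) ^ k * (ε * Q) ^ 3) (sym εQ) ⟩
  (Q + ε * Q) ^ k * (ε * Q) ^ 3                      ≡⟨ cong (λ x → x ^ k * (ε * Q) ^ 3) (solve 2 (λ e q → q :+ e :* q := (con 1ℚ :+ e) :* q) refl ε Q) ⟩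
  ((1ℚ + ε) * Q) ^ k * (ε * Q) ^ 3                   ≡⟨ cong (_* (ε * Q) ^ 3) (^-distrib-* (1ℚ + ε) Q k) ⟩
  (1ℚ + ε) ^ k * Q ^ k * (ε * Q) ^ 3
    ≡⟨ solve 4 (λ e q x y → x :* y :* (e :* q :* (e :* q :* (e :* q :* con 1ℚ))) := x :* (e :* (e :* e)) :* (q :* (q :* (q :* con 1ℚ)) :* y)) refl ε Q ((1ℚ + ε) ^ k) (Q ^ k) ⟩
  (1ℚ + ε) ^ k * (ε * (ε * ε)) * (Q ^ 3 * Q ^ k)     ∎)
  where
  open ≤-Reasoning
  p = ∣ ↥ ε ∣
  q = ↧ₙ ε
  Q = fromℕ q
  εQ = numerator-≡ ε 0<ε

-- Vertex potentials and their sums.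

vertices : List Edge → List ℕ
vertices []      = []
vertices (e ∷ M) = u e ∷ v e ∷ vertices M

total : (ℕ → ℚ) → List ℕ → ℚ
total φ []       = 0ℚ
total φ (x ∷ xs) = φ x + total φ xs

bump : (ℕ → ℚ) → Edge → ℚ → (ℕ → ℚ)
bump φ e d = update (update φ (u e) d) (v e) d

update-at : ∀ φ x d → update φ x d x ≡ φ x + d
update-at φ x d = cong (λ b → if b then φ x + d else φ x) (dec-true (x ℕ.≟ x) refl)

update-off : ∀ φ x d {y} → y ≢ x → update φ x d y ≡ φ y
update-off φ x d {y} y≢x = cong (λ b → if b then φ y + d else φ y) (dec-false (y ℕ.≟ x) y≢x)

update-≥ : ∀ φ x {d} y → 0ℚ ≤ d → φ y ≤ update φ x d y
update-≥ φ x {d} y 0≤d with y ℕP.≟ x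
... | yes refl = ≤-from-slack d (update-at φ y d) 0≤d
... | no  y≢x  = ≤-reflexive (sym (update-off φ x d y≢x))

bump-≥ : ∀ φ e {d} y → 0ℚ ≤ d → φ y ≤ bump φ e d y
bump-≥ φ e {d} y 0≤d = ≤-trans (update-≥ φ (u e) y 0≤d) (update-≥ (update φ (u e) d) (v e) y 0≤d)

bump-at-u : ∀ φ e d → u e ≢ v e → bump φ e d (u e) ≡ φ (u e) + d
bump-at-u φ e d u≢v = trans (update-off (update φ (u e) d) (v e) d u≢v) (update-at φ (u e) d)

bump-at-v : ∀ φ e d → u e ≢ v e → bump φ e d (v e) ≡ φ (v e) + d
bump-at-v φ e d u≢v = trans (update-at (update φ (u e) d) (v e) d) (cong (_+ d) (update-off φ (u e) d (u≢v ∘ sym)))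

incident-true : ∀ x e → incident x e ≡ true → u e ≡ x ⊎ v e ≡ x
incident-true x e eq with u e ℕP.≟ x | v e ℕP.≟ x
... | yes p | _     = inj₁ p
... | no _  | yes p = inj₂ p
... | no ¬p | no ¬q with trans (sym eq) (cong₂ _∨_ (dec-false (u e ℕ.≟ x) ¬p) (dec-false (v e ℕ.≟ x) ¬q))
...   | ()

bump-incident : ∀ φ e {d} x → 0ℚ ≤ d → u e ≡ x ⊎ v e ≡ x → φ x + d ≤ bump φ e d x
bump-incident φ e {d} x 0≤d (inj₁ refl) =
  ≤-trans (≤-reflexive (sym (update-at φ x d))) (update-≥ (update φ (u e) d) (v e) x 0≤d)
bump-incident φ e {d} x 0≤d (inj₂ refl) =
  ≤-trans (+-monoˡ-≤ d (update-≥ φ (u e) x 0≤d)) (≤-reflexive (sym (update-at (update φ (u e) d) x d)))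

total-mono : ∀ {φ ψ} → (∀ x → φ x ≤ ψ x) → ∀ xs → total φ xs ≤ total ψ xs
total-mono φ≤ψ []       = ≤-refl
total-mono φ≤ψ (x ∷ xs) = +-mono-≤ (φ≤ψ x) (total-mono φ≤ψ xs)

total-++ : ∀ φ M N → total φ (vertices (M ++ N)) ≡ total φ (vertices M) + total φ (vertices N)
total-++ φ []      N = sym (+-identityˡ _)
total-++ φ (e ∷ M) N = trans (cong (λ t → φ (u e) + (φ (v e) + t)) (total-++ φ M N))
  (solve 4 (λ a b c d → a :+ (b :+ (c :+ d)) := a :+ (b :+ c) :+ d) refl
    (φ (u e)) (φ (v e)) (total φ (vertices M)) (total φ (vertices N)))

weight-++ : ∀ M N → weight (M ++ N) ≡ weight M + weight N
weight-++ []      N = sym (+-identityˡ _)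
weight-++ (e ∷ M) N = trans (cong (λ t → w e + t) (weight-++ M N)) (sym (+-assoc (w e) _ _))

total-nonNeg : ∀ {φ} → (∀ x → 0ℚ ≤ φ x) → ∀ xs → 0ℚ ≤ total φ xs
total-nonNeg 0≤φ []       = ≤-refl
total-nonNeg 0≤φ (x ∷ xs) = 0≤+ (0≤φ x) (total-nonNeg 0≤φ xs)

total-update-∉ : ∀ φ x d {xs} → x ∉ xs → total (update φ x d) xs ≡ total φ xs
total-update-∉ φ x d {[]}     _    = refl
total-update-∉ φ x d {y ∷ xs} x∉xs =
  cong₂ _+_ (update-off φ x d (λ y≡x → x∉xs (here (sym y≡x)))) (total-update-∉ φ x d (x∉xs ∘ there))

total-update-∈ : ∀ φ x {d xs} → 0ℚ ≤ d → x ∈ xs → total φ xs + d ≤ total (update φ x d) xs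
total-update-∈ φ x {d} {_ ∷ xs} 0≤d (here refl) = ≤-trans
  (≤-reflexive (trans (solve 3 (λ a b c → a :+ b :+ c := a :+ c :+ b) refl (φ x) (total φ xs) d) (cong (_+ total φ xs) (sym (update-at φ x d)))))
  (+-monoʳ-≤ (update φ x d x) (total-mono (λ y → update-≥ φ x y 0≤d) xs))
total-update-∈ φ x {d} {y ∷ xs} 0≤d (there x∈xs) = ≤-trans
  (≤-reflexive (+-assoc (φ y) (total φ xs) d))
  (+-mono-≤ (update-≥ φ x y 0≤d) (total-update-∈ φ x 0≤d x∈xs))

total-update-≤ : ∀ φ x {d xs} → 0ℚ ≤ d → Unique xs → total (update φ x d) xs ≤ total φ xs + d
total-update-≤ φ x {d} {[]} 0≤d [] = ≤-trans 0≤d (≤-reflexive (sym (+-identityˡ d)))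
total-update-≤ φ x {d} {y ∷ xs} 0≤d (y∉xs ∷ uniq) with y ℕP.≟ x
... | yes refl = ≤-reflexive (trans
      (cong₂ _+_ (update-at φ x d) (total-update-∉ φ x d (λ x∈xs → All.lookup y∉xs x∈xs refl)))
      (solve 3 (λ a b c → a :+ c :+ b := a :+ b :+ c) refl (φ x) (total φ xs) d))
... | no y≢x = ≤-trans
      (+-mono-≤ (≤-reflexive (update-off φ x d y≢x)) (total-update-≤ φ x 0≤d uniq))
      (≤-reflexive (sym (+-assoc (φ y) (total φ xs) d)))

-- Source of the factor 2 between potentials and reduced weights: an accepted edge contributes once
-- per endpoint. Distinct `xs` keep a raised vertex from being counted repeatedly.
total-bump-≤ : ∀ φ e {d xs} → 0ℚ ≤ d → Unique xs → total (bump φ e d) xs ≤ total φ xs + d + d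
total-bump-≤ φ e {d} 0≤d uniq = ≤-trans (total-update-≤ (update φ (u e) d) (v e) 0≤d uniq) (+-monoˡ-≤ d (total-update-≤ φ (u e) 0≤d uniq))

total-bump-∉ : ∀ φ e d {xs} → u e ∉ xs → v e ∉ xs → total (bump φ e d) xs ≡ total φ xs
total-bump-∉ φ e d u∉ v∉ = trans (total-update-∉ (update φ (u e) d) (v e) d v∉) (total-update-∉ φ (u e) d u∉)

total-bump-∈ : ∀ φ e {d xs} → 0ℚ ≤ d → u e ∈ xs ⊎ v e ∈ xs → total φ xs + d ≤ total (bump φ e d) xs
total-bump-∈ φ e {d} {xs} 0≤d (inj₁ u∈) = ≤-trans (total-update-∈ φ (u e) 0≤d u∈) (total-mono (λ y → update-≥ (update φ (u e) d) (v e) y 0≤d) xs)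
total-bump-∈ φ e {d} {xs} 0≤d (inj₂ v∈) = ≤-trans (+-monoˡ-≤ d (total-mono (λ y → update-≥ φ (u e) y 0≤d) xs)) (total-update-∈ (update φ (u e) d) (v e) 0≤d v∈)

-- Matchings in terms of their vertex lists.

disjoint-∉ : ∀ e {M} → All (Disjoint e) M → u e ∉ vertices M × v e ∉ vertices M
disjoint-∉ e []       = (λ ()) , (λ ())
disjoint-∉ e ((uu , uv , vu , vv) ∷ ds) with disjoint-∉ e ds
... | u∉ , v∉ =
  (λ { (here eq) → uu eq ; (there (here eq)) → uv eq ; (there (there p)) → u∉ p }) ,
  (λ { (here eq) → vu eq ; (there (here eq)) → vv eq ; (there (there p)) → v∉ p })

∉-disjoint : ∀ e M → u e ∉ vertices M → v e ∉ vertices M → All (Disjoint e) M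
∉-disjoint e []      _  _  = []
∉-disjoint e (f ∷ M) u∉ v∉ =
  (u∉ ∘ here , u∉ ∘ there ∘ here , v∉ ∘ here , v∉ ∘ there ∘ here) ∷ ∉-disjoint e M (u∉ ∘ there ∘ there) (v∉ ∘ there ∘ there)

conflict-∈ : ∀ e M → ¬ All (Disjoint e) M → u e ∈ vertices M ⊎ v e ∈ vertices M
conflict-∈ e M ¬d with u e ∈? vertices M | v e ∈? vertices M
... | yes u∈ | _      = inj₁ u∈
... | no _   | yes v∈ = inj₂ v∈
... | no u∉  | no v∉  = ⊥-elim (¬d (∉-disjoint e M u∉ v∉))

NoLoop : Edge → Set
NoLoop e = u e ≢ v e

vertices-unique : ∀ {M} → All NoLoop M → AllPairs Disjoint M → Unique (vertices M)
vertices-unique []         []         = []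
vertices-unique {e ∷ M} (u≢v ∷ ok) (ds ∷ dss) with disjoint-∉ e ds
... | u∉ , v∉ = (u≢v ∷ AllP.¬Any⇒All¬ _ u∉) ∷ AllP.¬Any⇒All¬ _ v∉ ∷ vertices-unique ok dss

-- Greedy unwinding of a stack.

all-disjoint? : ∀ e M → Dec (All (Disjoint e) M)
all-disjoint? e M = All.all? (disjoint? e) M

-- Edges are popped newest first and consed on, so the result is in arrival order, as a sublist of
-- the stream must be.
unwind-⊆ : ∀ M st → unwind M st ⊆ st ʳ++ M
unwind-⊆ M []       = ⊆-refl
unwind-⊆ M (e ∷ st) with all-disjoint? e M
... | yes ds = unwind-⊆ (e ∷ M) st
... | no ¬ds = ⊆-trans (unwind-⊆ M st) (ʳ++⁺ {as = st} ⊆-refl (e ∷ʳ ⊆-refl))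

unwind-matching : ∀ {M} st → AllPairs Disjoint M → AllPairs Disjoint (unwind M st)
unwind-matching []       dss = dss
unwind-matching {M} (e ∷ st) dss with all-disjoint? e M
... | yes ds = unwind-matching st (ds ∷ dss)
... | no ¬ds = unwind-matching st dss

unwind-All : ∀ {P : Edge → Set} {M st} → All P st → All P M → All P (unwind M st)
unwind-All                []                       pM = pM
unwind-All {P} {M} {e ∷ st} (pe ∷ pst) pM with all-disjoint? e M
... | yes ds = unwind-All pst (pe ∷ pM)
... | no ¬ds = unwind-All pst pM

gain : (ℕ → ℚ) → Edge → ℚ
gain φ e = w e - (φ (u e) + φ (v e))

-- Counting and removing stacked edges at a vertex.

count-⊆ : ∀ x {st st′} → st ⊆ st′ → count x st ℕ.≤ count x st′
count-⊆ x [] = z≤n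
count-⊆ x (e ∷ʳ sub) with incident x e
... | true  = ℕP.m≤n⇒m≤1+n (count-⊆ x sub)
... | false = count-⊆ x sub
count-⊆ x (_∷_ {x = e} refl sub) with incident x e
... | true  = s≤s (count-⊆ x sub)
... | false = count-⊆ x sub

count-push : ∀ x e st → count x (e ∷ st) ℕ.≤ suc (count x st)
count-push x e st with incident x e
... | true  = ℕP.≤-refl
... | false = ℕP.n≤1+n _

count-push-other : ∀ {x} e st → u e ≢ x → v e ≢ x → count x (e ∷ st) ≡ count x st
count-push-other {x} e st u≢x v≢x = cong (λ b → if b then suc (count x st) else count x st)
  (cong₂ _∨_ (dec-false (u e ℕ.≟ x) u≢x) (dec-false (v e ℕ.≟ x) v≢x))

count-++ : ∀ x st st′ → count x (st ++ st′) ≡ count x st ℕ.+ count x st′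
count-++ x []       st′ = refl
count-++ x (e ∷ st) st′ with incident x e
... | true  = cong suc (count-++ x st st′)
... | false = count-++ x st st′

count-reverse : ∀ x st → count x (reverse st) ≡ count x st
count-reverse x []       = refl
count-reverse x (e ∷ st) = begin
  count x (reverse (e ∷ st))              ≡⟨ cong (count x) (List.unfold-reverse e st) ⟩
  count x (reverse st ++ [ e ])           ≡⟨ count-++ x (reverse st) [ e ] ⟩
  count x (reverse st) ℕ.+ count x [ e ]  ≡⟨ cong (ℕ._+ count x [ e ]) (count-reverse x st) ⟩
  count x st ℕ.+ count x [ e ]            ≡⟨ ℕP.+-comm (count x st) _ ⟩
  count x [ e ] ℕ.+ count x st            ≡⟨ count-++ x [ e ] st ⟨
  count x (e ∷ st)                        ∎
  where open ≡-Reasoning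

removeFirst-⊆ : ∀ x st → removeFirst x st ⊆ st
removeFirst-⊆ x []       = []
removeFirst-⊆ x (e ∷ st) with incident x e
... | true  = e ∷ʳ ⊆-refl
... | false = refl ∷ removeFirst-⊆ x st

removeFirst-split : ∀ x st {c} → count x st ≡ suc c →
  ∃[ st₁ ] ∃[ e ] ∃[ st₂ ] (st ≡ st₁ ++ e ∷ st₂) × (removeFirst x st ≡ st₁ ++ st₂) × (incident x e ≡ true) × (count x st₂ ≡ c)
removeFirst-split x (e ∷ st) eq with incident x e in inc
... | true  = [] , e , st , refl , refl , inc , ℕP.suc-injective eq
... | false with removeFirst-split x st eq
...   | st₁ , f , st₂ , p , q , r , s = e ∷ st₁ , f , st₂ , cong (e ∷_) p , cong (e ∷_) q , r , s

-- All other edges at `x` lie in the newer part `st₁`; their number `c` becomes the exponent of 1 +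
-- ε when an eviction is charged.
removeOldest-split : ∀ x st {c} → count x st ≡ suc c →
  ∃[ st₁ ] ∃[ e ] ∃[ st₂ ] (st ≡ st₁ ++ e ∷ st₂) × (removeOldest x st ≡ st₁ ++ st₂) × (incident x e ≡ true) × (count x st₁ ≡ c)
removeOldest-split x st eq with removeFirst-split x (reverse st) (trans (count-reverse x st) eq)
... | l₁ , e , l₂ , p , q , r , s = reverse l₂ , e , reverse l₁ ,
  (begin
    st                                   ≡⟨ List.reverse-involutive st ⟨
    reverse (reverse st)                 ≡⟨ cong reverse p ⟩
    reverse (l₁ ++ e ∷ l₂)               ≡⟨ List.reverse-++ l₁ (e ∷ l₂) ⟩
    reverse (e ∷ l₂) ++ reverse l₁       ≡⟨ cong (_++ reverse l₁) (List.unfold-reverse e l₂) ⟩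
    (reverse l₂ ++ [ e ]) ++ reverse l₁  ≡⟨ List.++-assoc (reverse l₂) [ e ] (reverse l₁) ⟩
    reverse l₂ ++ e ∷ reverse l₁         ∎) ,
  trans (cong reverse q) (List.reverse-++ l₁ l₂) , r , trans (count-reverse x l₂) s
  where open ≡-Reasoning

⊆-++⁻ : ∀ {A : Set} (S : List A) {T M} → M ⊆ S ++ T → ∃[ M₁ ] ∃[ M₂ ] (M ≡ M₁ ++ M₂) × (M₁ ⊆ S) × (M₂ ⊆ T)
⊆-++⁻ []      sub = [] , _ , refl , [] , sub
⊆-++⁻ (e ∷ S) (.e ∷ʳ sub) with ⊆-++⁻ S sub
... | M₁ , M₂ , eq , p , q = M₁ , M₂ , eq , e ∷ʳ p , q
⊆-++⁻ (e ∷ S) (refl ∷ sub) with ⊆-++⁻ S sub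
... | M₁ , M₂ , eq , p , q = e ∷ M₁ , M₂ , cong (e ∷_) eq , refl ∷ p , q

AllPairs-++⁻ˡ : ∀ {A : Set} {_~_ : A → A → Set} M {N} → AllPairs _~_ (M ++ N) → AllPairs _~_ M
AllPairs-++⁻ˡ []      _          = []
AllPairs-++⁻ˡ (e ∷ M) (ds ∷ dss) = AllP.++⁻ˡ M ds ∷ AllPairs-++⁻ˡ M dss

-- Histories of accepted edges: the unwinding bound and the cost of an eviction.

module Analysis (ε : ℚ) (0<ε : 0ℚ < ε) (ε≤⅒ : ε ≤ + 1 / 10) where

  0≤ε : 0ℚ ≤ ε
  0≤ε = <⇒≤ 0<ε

  Accepted : (ℕ → ℚ) → Edge → Set
  Accepted φ e = (1ℚ + ε) * (φ (u e) + φ (v e)) ≤ w e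

  -- History st φ R: the potentials φ arise from accepted edges of which those in st are still stacked, with total
  -- reduced weight R; a dropped edge keeps its contribution to φ.
  data History : List Edge → (ℕ → ℚ) → ℚ → Set where
    start : History [] (λ _ → 0ℚ) 0ℚ
    keep  : ∀ {st φ R} e → Accepted φ e → History st φ R →
            History (e ∷ st) (bump φ e (gain φ e)) (R + gain φ e)
    drop  : ∀ {st φ R} e → Accepted φ e → History st φ R →
            History st (bump φ e (gain φ e)) R

  gain-≥ : ∀ φ e → Accepted φ e → ε * (φ (u e) + φ (v e)) ≤ gain φ e
  gain-≥ φ e acc = ≤-from-slack (w e - (1ℚ + ε) * s)
    (solve 3 (λ a e s → a :- s := e :* s :+ (a :- (con 1ℚ :+ e) :* s)) refl (w e) ε s) (0≤- acc)
    where s = φ (u e) + φ (v e)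

  gain-nonNeg : ∀ φ e → (∀ x → 0ℚ ≤ φ x) → Accepted φ e → 0ℚ ≤ gain φ e
  gain-nonNeg φ e 0≤φ acc = ≤-trans (0≤* 0≤ε (0≤+ (0≤φ (u e)) (0≤φ (v e)))) (gain-≥ φ e acc)

  φ-nonNeg : ∀ {st φ R} → History st φ R → ∀ x → 0ℚ ≤ φ x
  φ-nonNeg start                x = ≤-refl
  φ-nonNeg (keep {φ = φ} e acc h) x = ≤-trans (φ-nonNeg h x) (bump-≥ φ e x (gain-nonNeg φ e (φ-nonNeg h) acc))
  φ-nonNeg (drop {φ = φ} e acc h) x = ≤-trans (φ-nonNeg h x) (bump-≥ φ e x (gain-nonNeg φ e (φ-nonNeg h) acc))

  R-nonNeg : ∀ {st φ R} → History st φ R → 0ℚ ≤ R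
  R-nonNeg start                    = ≤-refl
  R-nonNeg (keep {φ = φ} e acc h) = 0≤+ (R-nonNeg h) (gain-nonNeg φ e (φ-nonNeg h) acc)
  R-nonNeg (drop e acc h)           = R-nonNeg h

  -- Induction on the history, undoing the newest edge first. `M` is universally quantified because
  -- a popped edge may join it before the rest of the stack is unwound.
  unwind-bound : ∀ {st φ R} → History st φ R → ∀ M →
    weight M + R ≤ weight (unwind M st) + total φ (vertices M)
  unwind-bound start M = +-monoʳ-≤ (weight M) (total-nonNeg (λ _ → ≤-refl) (vertices M))
  unwind-bound (drop {st} {φ} e acc h) M = ≤-trans (unwind-bound h M)
    (+-monoʳ-≤ (weight (unwind M st)) (total-mono (λ x → bump-≥ φ e x (gain-nonNeg φ e (φ-nonNeg h) acc)) (vertices M)))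
  unwind-bound (keep {st} {φ} {R} e acc h) M with all-disjoint? e M
  -- The edge joins the matching. Its weight is its reduced weight plus the old potentials of its
  -- endpoints, which is what the hypothesis for `e ∷ M` charges; its bump leaves the vertices of
  -- `M` untouched.
  ... | yes ds = ≤-from-slack ((X + (a + (b + T))) - ((w e + weight M) + R))
        (trans (cong (λ t → X + t) (total-bump-∉ φ e (gain φ e) (proj₁ (disjoint-∉ e ds)) (proj₂ (disjoint-∉ e ds))))
          (solve 7 (λ X T a b c m R → X :+ T := m :+ (R :+ (c :- (a :+ b))) :+ ((X :+ (a :+ (b :+ T))) :- ((c :+ m) :+ R)))
            refl X T a b (w e) (weight M) R))
        (0≤- (unwind-bound h (e ∷ M)))
    where
    X = weight (unwind (e ∷ M) st)
    T = total φ (vertices M)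
    a = φ (u e)
    b = φ (v e)
  -- A blocked edge meets `M`, and the rise of the potential at a shared endpoint pays for its
  -- reduced weight.
  ... | no ¬ds = begin
    weight M + (R + g)                            ≡⟨ +-assoc (weight M) R g ⟨
    weight M + R + g                              ≤⟨ +-monoˡ-≤ g (unwind-bound h M) ⟩
    X + total φ (vertices M) + g                  ≡⟨ +-assoc X _ g ⟩
    X + (total φ (vertices M) + g)                ≤⟨ +-monoʳ-≤ X (total-bump-∈ φ e (gain-nonNeg φ e (φ-nonNeg h) acc) (conflict-∈ e M ¬ds)) ⟩
    X + total (bump φ e g) (vertices M)           ∎
    where
    open ≤-Reasoning
    g = gain φ e
    X = weight (unwind M st)

  -- Turning the `keep` of `e` into a `drop` leaves every potential unchanged and costs only `d`,
  -- the reduced weight of `e`. The last bound holds because each later stacked edge at `x` gains at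
  -- least ε times the potential at `x`.
  evict : ∀ {φ R} st₁ e {st₂} → History (st₁ ++ e ∷ st₂) φ R →
    ∃[ d ] ∃[ R′ ] History (st₁ ++ st₂) φ R′ × (R ≤ R′ + d) × (0ℚ ≤ d) ×
      (∀ x → incident x e ≡ true → d * (1ℚ + ε) ^ count x st₁ ≤ φ x)
  evict [] e (drop {φ = φ} f acc h) with evict [] e h
  ... | d , R′ , h′ , R≤ , 0≤d , d≤ = d , R′ , drop f acc h′ , R≤ , 0≤d ,
        λ x inc → ≤-trans (d≤ x inc) (bump-≥ φ f x (gain-nonNeg φ f (φ-nonNeg h) acc))
  evict st₁@(_ ∷ _) e (drop {φ = φ} f acc h) with evict st₁ e h
  ... | d , R′ , h′ , R≤ , 0≤d , d≤ = d , R′ , drop f acc h′ , R≤ , 0≤d ,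
        λ x inc → ≤-trans (d≤ x inc) (bump-≥ φ f x (gain-nonNeg φ f (φ-nonNeg h) acc))
  evict [] e (keep {φ = φ} {R} .e acc h) = gain φ e , R , drop e acc h , ≤-refl , 0≤g ,
    λ x inc → ≤-trans (≤-trans (≤-reflexive (*-identityʳ (gain φ e))) (≤-from-slack (φ x) (+-comm (φ x) (gain φ e)) (φ-nonNeg h x)))
      (bump-incident φ e x 0≤g (incident-true x e inc))
    where 0≤g = gain-nonNeg φ e (φ-nonNeg h) acc
  evict (f ∷ st₁) e (keep {φ = φ} {R} .f acc h) with evict st₁ e h
  ... | d , R′ , h′ , R≤ , 0≤d , d≤ = d , R′ + g , keep f acc h′ ,
        ≤-trans (+-monoˡ-≤ g R≤) (≤-reflexive (solve 3 (λ a b c → a :+ b :+ c := a :+ c :+ b) refl R′ d g)) , 0≤d , grow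
    where
    g = gain φ f
    0≤g = gain-nonNeg φ f (φ-nonNeg h) acc
    endpoint-≤ : ∀ x → u f ≡ x ⊎ v f ≡ x → φ x ≤ φ (u f) + φ (v f)
    endpoint-≤ x (inj₁ refl) = ≤-from-slack (φ (v f)) refl (φ-nonNeg h (v f))
    endpoint-≤ x (inj₂ refl) = ≤-from-slack (φ (u f)) (+-comm (φ (u f)) (φ (v f))) (φ-nonNeg h (u f))
    grow : ∀ x → incident x e ≡ true → d * (1ℚ + ε) ^ count x (f ∷ st₁) ≤ bump φ f g x
    grow x inc with incident x f in eq
    ... | false = ≤-trans (d≤ x inc) (bump-≥ φ f x 0≤g)
    ... | true  = begin
      d * ((1ℚ + ε) * p)                  ≡⟨ solve 3 (λ d e p → d :* ((con 1ℚ :+ e) :* p) := d :* p :+ e :* (d :* p)) refl d ε p ⟩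
      d * p + ε * (d * p)                 ≤⟨ +-mono-≤ (d≤ x inc) (*-monoˡ-≤-nonNeg ε {{nonNegative 0≤ε}} (≤-trans (d≤ x inc) (endpoint-≤ x end))) ⟩
      φ x + ε * (φ (u f) + φ (v f))       ≤⟨ +-monoʳ-≤ (φ x) (gain-≥ φ f acc) ⟩
      φ x + g                             ≤⟨ bump-incident φ f x 0≤g end ⟩
      bump φ f g x                        ∎
      where
      open ≤-Reasoning
      p = (1ℚ + ε) ^ count x st₁
      end = incident-true x f eq

  -- Of the three factors ε, one turns y into (1 + ε)g through the hypothesis on ε * y; the other
  -- two leave ε²(1 + ε)g, which is at most εg.
  eviction-small : ∀ {d y g k} → 0ℚ ≤ d → 0ℚ ≤ g → d * (1ℚ + ε) ^ k ≤ y → ε * y ≤ (1ℚ + ε) * g →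
    1ℚ ≤ (1ℚ + ε) ^ k * (ε * (ε * ε)) → d ≤ ε * g
  eviction-small {d} {y} {g} {k} 0≤d 0≤g d≤y y≤g 1≤ = begin
    d                                ≡⟨ *-identityʳ d ⟨
    d * 1ℚ                           ≤⟨ *-monoˡ-≤-nonNeg d {{nonNegative 0≤d}} 1≤ ⟩
    d * (p * (ε * (ε * ε)))          ≡⟨ solve 3 (λ d p e → d :* (p :* (e :* (e :* e))) := e :* e :* (e :* (d :* p))) refl d p ε ⟩
    ε * ε * (ε * (d * p))            ≤⟨ *-monoˡ-≤-nonNeg (ε * ε) {{nonNegative (0≤* 0≤ε 0≤ε)}} (≤-trans (*-monoˡ-≤-nonNeg ε {{nonNegative 0≤ε}} d≤y) y≤g) ⟩
    -- The bracket in the slack is 1 - ε(1 + ε), split so that its sign is visible: 89/100 is its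
    -- value at ε = 1/10.
    ε * ε * ((1ℚ + ε) * g)           ≤⟨ ≤-from-slack (ε * g * ((c - ε) * (1ℚ + ε + c) + + 89 / 100))
      (solve 2 (λ e g → e :* g := e :* e :* ((con 1ℚ :+ e) :* g) :+ e :* g :* ((con c :- e) :* (con 1ℚ :+ e :+ con c) :+ con (+ 89 / 100))) refl ε g)
      (0≤* (0≤* 0≤ε 0≤g) (0≤+ (0≤* (0≤- ε≤⅒) (0≤+ (0≤+ (nonNegative⁻¹ 1ℚ) 0≤ε) (nonNegative⁻¹ c))) (nonNegative⁻¹ (+ 89 / 100)))) ⟩
    ε * g                            ∎
    where
    open ≤-Reasoning
    p = (1ℚ + ε) ^ k
    c = + 1 / 10

  -- Stack sizes and losses under trimming.

  exceedsBound-antitone : ∀ {m n} → m ℕ.≤ n → exceedsBound ε n ≡ false → exceedsBound ε m ≡ false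
  exceedsBound-antitone z≤n               _  = refl
  exceedsBound-antitone (s≤s {m} {n} m≤n) no-excess = dec-false (_ ℕ.<? _) λ exceeds →
    does-false (_ ℕ.<? _) no-excess (ℕP.<-≤-trans exceeds
      (ℕP.*-monoˡ-≤ (p ℕ.^ (3 ℕ.* q)) (ℕP.^-monoʳ-≤ 2 (ℕP.*-monoʳ-≤ p m≤n))))
    where
    p = ∣ ↥ ε ∣
    q = ↧ₙ ε

  exceedsBound-suc : ∀ n → exceedsBound ε n ≡ true → ∃[ k ] n ≡ suc k
  exceedsBound-suc (suc k) _ = k , refl

  trim-⊆ : ∀ x st → trim ε x st ⊆ st
  trim-⊆ x st with exceedsBound ε (count x st)
  ... | true  = subst (removeOldest x st ⊆_) (List.reverse-involutive st) (reverse⁺ (removeFirst-⊆ x (reverse st)))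
  ... | false = ⊆-refl

  Bounded : List Edge → Set
  Bounded st = ∀ x → exceedsBound ε (count x st) ≡ false

  -- Here `n` is the admissible count before a push. A push adds at most one edge at `x`, so a
  -- single removal restores the bound.
  trim-bounded : ∀ x st {n} → exceedsBound ε n ≡ false → count x st ℕ.≤ suc n →
    exceedsBound ε (count x (trim ε x st)) ≡ false
  trim-bounded x st {n} bound c≤ with exceedsBound ε (count x st) in eq
  ... | false = eq
  ... | true with exceedsBound-suc (count x st) eq
  ...   | k , c≡ with removeOldest-split x st c≡
  ...     | st₁ , e , st₂ , st≡ , removed≡ , inc , _ = exceedsBound-antitone (ℕ.s≤s⁻¹ (ℕP.≤-trans (ℕP.≤-reflexive one-less) c≤)) bound
    where
    open ≡-Reasoning
    one-less : suc (count x (removeOldest x st)) ≡ count x st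
    one-less = begin
      suc (count x (removeOldest x st))          ≡⟨ cong (suc ∘ count x) removed≡ ⟩
      suc (count x (st₁ ++ st₂))                 ≡⟨ cong suc (count-++ x st₁ st₂) ⟩
      suc (count x st₁ ℕ.+ count x st₂)          ≡⟨ ℕP.+-suc (count x st₁) (count x st₂) ⟨
      count x st₁ ℕ.+ suc (count x st₂)          ≡⟨ cong (λ b → count x st₁ ℕ.+ (if b then suc (count x st₂) else count x st₂)) inc ⟨
      count x st₁ ℕ.+ count x (e ∷ st₂)          ≡⟨ count-++ x st₁ (e ∷ st₂) ⟨
      count x (st₁ ++ e ∷ st₂)                   ≡⟨ cong (count x) st≡ ⟨
      count x st                                 ∎

  trim-idle : ∀ x st → Bounded st → trim ε x st ≡ st
  trim-idle x st bounded = cong (λ b → if b then removeOldest x st else st) (bounded x)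

  -- Trimming only deletes edges, so the trim at one endpoint cannot spoil the count at the other,
  -- and at all other vertices the push adds nothing.
  trim-push-bounded : ∀ e {st} → Bounded st → Bounded (trim ε (v e) (trim ε (u e) (e ∷ st)))
  trim-push-bounded e {st} bounded x with u e ℕP.≟ x | v e ℕP.≟ x
  ... | yes refl | _ = exceedsBound-antitone (count-⊆ x (trim-⊆ (v e) (trim ε (u e) (e ∷ st))))
          (trim-bounded x (e ∷ st) (bounded x) (count-push x e st))
  ... | no _ | yes refl = trim-bounded x (trim ε (u e) (e ∷ st)) (bounded x)
          (ℕP.≤-trans (count-⊆ x (trim-⊆ (u e) (e ∷ st))) (count-push x e st))
  ... | no u≢x | no v≢x = exceedsBound-antitone
          (ℕP.≤-trans (count-⊆ x (⊆-trans (trim-⊆ (v e) (trim ε (u e) (e ∷ st))) (trim-⊆ (u e) (e ∷ st)))) (ℕP.≤-reflexive (count-push-other e st u≢x v≢x)))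
          (bounded x)

  ε≤1 : ε ≤ 1ℚ
  ε≤1 = ≤-trans ε≤⅒ (≤-from-slack (+ 9 / 10) refl (nonNegative⁻¹ (+ 9 / 10)))

  -- Charges a possible eviction at `x` to the edge just pushed: `g` is its reduced weight and `φ`
  -- already includes its bump.
  trim-loss : ∀ x {st φ R g} → History st φ R → 0ℚ ≤ g → ε * φ x ≤ (1ℚ + ε) * g →
    ∃[ R′ ] History (trim ε x st) φ R′ × (R ≤ R′ + ε * g)
  trim-loss x {st} {φ} {R} {g} h 0≤g φ≤g with exceedsBound ε (count x st) in eq
  ... | false = R , h , ≤-from-slack (ε * g) refl (0≤* 0≤ε 0≤g)
  ... | true with exceedsBound-suc (count x st) eq
  ...   | k , c≡ with removeOldest-split x st c≡
  -- The count is `suc k`, so exactly `k` newer edges at `x` remain, matching the exponent in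
  -- `exceedsBound-growth`.
  ...     | st₁ , e , st₂ , refl , removed≡ , inc , c₁≡ with evict st₁ e h
  ...       | d , R′ , h′ , R≤ , 0≤d , d≤ =
    R′ , subst (λ s → History s φ R′) (sym removed≡) h′ ,
    ≤-trans R≤ (+-monoʳ-≤ R′ (eviction-small {k = k} 0≤d 0≤g (subst (λ c → d * (1ℚ + ε) ^ c ≤ φ x) c₁≡ (d≤ x inc)) φ≤g
      (exceedsBound-growth ε k 0<ε ε≤1 (trans (cong (exceedsBound ε) (sym c≡)) eq))))

  -- The invariant maintained along a run.

  data Step (σ : AlgState) (e : Edge) : AlgState → Set where
    reject : w e < (1ℚ + ε) * (φ σ (u e) + φ σ (v e)) →
             Step σ e (mkState (trim ε (v e) (trim ε (u e) (stack σ))) (φ σ) (W' σ))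
    accept : Accepted (φ σ) e →
             Step σ e (mkState (trim ε (v e) (trim ε (u e) (e ∷ stack σ)))
                               (bump (φ σ) e (gain (φ σ) e)) (W' σ + gain (φ σ) e))

  step-view : ∀ σ e → Step σ e (step ε σ e)
  step-view σ e = decide (w e <? bar)
    where
    bar = (1ℚ + ε) * (φ σ (u e) + φ σ (v e))
    branch : Bool → AlgState
    branch b = if b
      then mkState (trim ε (v e) (trim ε (u e) (stack σ))) (φ σ) (W' σ)
      else mkState (trim ε (v e) (trim ε (u e) (e ∷ stack σ)))
                   (bump (φ σ) e (gain (φ σ) e)) (W' σ + gain (φ σ) e)
    decide : Dec (w e < bar) → Step σ e (branch (does (w e <? bar)))
    decide (yes lt) = subst (λ b → Step σ e (branch b)) (sym (dec-true (w e <? bar) lt)) (reject lt)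
    decide (no ¬lt) = subst (λ b → Step σ e (branch b)) (sym (dec-false (w e <? bar) ¬lt)) (accept (≮⇒≥ ¬lt))

  Covered : (ℕ → ℚ) → Edge → Set
  Covered φ e = w e ≤ (1ℚ + ε) * (φ (u e) + φ (v e))

  -- Two histories share the same potentials. `full` is a virtual stack that never evicts and
  -- carries all of W'; `hist` follows the actual stack and carries only `R`. The list `seen` is
  -- newest first, like the stacks.
  record Invariant (seen : List Edge) (σ : AlgState) : Set where
    field
      {full}    : List Edge
      full-hist : History full (φ σ) (W' σ)
      full-⊆    : full ⊆ seen
      {R}       : ℚ
      hist      : History (stack σ) (φ σ) R
      retained  : (1ℚ - (+ 2 / 1) * ε) * W' σ ≤ R
      stack-⊆   : stack σ ⊆ seen
      -- Hence a rejected edge never triggers an eviction, and every eviction can be charged to a push.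
      bounded   : Bounded (stack σ)
      covered   : All (Covered (φ σ)) seen
      half      : ∀ {xs} → Unique xs → total (φ σ) xs ≤ W' σ + W' σ
  open Invariant

  covered-mono : ∀ {φ ψ e} → (∀ x → φ x ≤ ψ x) → Covered φ e → Covered ψ e
  covered-mono {e = e} φ≤ψ c = ≤-trans c
    (*-monoˡ-≤-nonNeg (1ℚ + ε) {{nonNegative (0≤+ (nonNegative⁻¹ 1ℚ) 0≤ε)}} (+-mono-≤ (φ≤ψ (u e)) (φ≤ψ (v e))))

  -- With s the old potential sum and g the gain, w(e) = s + g, while the new sum is s + 2g.
  accepted-covered : ∀ φ e → (∀ x → 0ℚ ≤ φ x) → Accepted φ e → Covered (bump φ e (gain φ e)) e
  accepted-covered φ e 0≤φ acc = ≤-trans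
    (≤-from-slack (g + ε * (s + (g + g))) (solve 3 (λ a e s → (con 1ℚ :+ e) :* (s :+ ((a :- s) :+ (a :- s))) := a :+ ((a :- s) :+ e :* (s :+ ((a :- s) :+ (a :- s))))) refl (w e) ε s)
      (0≤+ 0≤g (0≤* 0≤ε (0≤+ (0≤+ (0≤φ (u e)) (0≤φ (v e))) (0≤+ 0≤g 0≤g)))))
    (*-monoˡ-≤-nonNeg (1ℚ + ε) {{nonNegative (0≤+ (nonNegative⁻¹ 1ℚ) 0≤ε)}}
      (≤-trans (≤-reflexive (solve 3 (λ a b g → a :+ b :+ (g :+ g) := a :+ g :+ (b :+ g)) refl (φ (u e)) (φ (v e)) g))
        (+-mono-≤ (bump-incident φ e (u e) 0≤g (inj₁ refl)) (bump-incident φ e (v e) 0≤g (inj₂ refl)))))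
    where
    g = gain φ e
    s = φ (u e) + φ (v e)
    0≤g = gain-nonNeg φ e 0≤φ acc

  step-invariant : ∀ {seen σ} e → NoLoop e → Invariant seen σ → Invariant (e ∷ seen) (step ε σ e)
  step-invariant {seen} {σ} e u≢v inv with step ε σ e | step-view σ e
  ... | _ | reject lt = record
    { full-hist = full-hist inv
    ; full-⊆    = e ∷ʳ full-⊆ inv
    ; hist      = subst (λ s → History s (φ σ) (R inv)) (sym idle) (hist inv)
    ; retained  = retained inv
    ; stack-⊆   = e ∷ʳ subst (_⊆ seen) (sym idle) (stack-⊆ inv)
    ; bounded   = subst Bounded (sym idle) (bounded inv)
    ; covered   = <⇒≤ lt ∷ covered inv
    ; half      = half inv
    }
    where
    idle : trim ε (v e) (trim ε (u e) (stack σ)) ≡ stack σ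
    idle = trans (cong (trim ε (v e)) (trim-idle (u e) (stack σ) (bounded inv))) (trim-idle (v e) (stack σ) (bounded inv))
  ... | _ | accept acc = record
    { full-hist = keep e acc (full-hist inv)
    ; full-⊆    = refl ∷ full-⊆ inv
    ; hist      = proj₁ (proj₂ trim-v)
    -- The push adds g to the retained weight and each of the two trims takes away at most εg, so
    -- the net growth is at least (1 - 2ε)g.
    ; retained  = ≤-from-slack (r - (1ℚ - (+ 2 / 1) * ε) * W' σ + ((R₁ + ε * g) - (r + g) + ((R₂ + ε * g) - R₁)))
        (solve 6 (λ r e W R₁ R₂ g → R₂ := (con 1ℚ :- con (+ 2 / 1) :* e) :* (W :+ g) :+ ((r :- (con 1ℚ :- con (+ 2 / 1) :* e) :* W) :+ ((R₁ :+ e :* g) :- (r :+ g) :+ ((R₂ :+ e :* g) :- R₁))))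
          refl r ε (W' σ) R₁ R₂ g)
        (0≤+ (0≤- (retained inv)) (0≤+ (0≤- (proj₂ (proj₂ trim-u))) (0≤- (proj₂ (proj₂ trim-v)))))
    ; stack-⊆   = ⊆-trans (trim-⊆ (v e) (trim ε (u e) (e ∷ stack σ))) (⊆-trans (trim-⊆ (u e) (e ∷ stack σ)) (refl ∷ stack-⊆ inv))
    ; bounded   = trim-push-bounded e (bounded inv)
    ; covered   = accepted-covered (φ σ) e 0≤φ acc ∷ All.map (covered-mono (λ x → bump-≥ (φ σ) e x 0≤g)) (covered inv)
    ; half      = λ {xs} uniq → ≤-trans (total-bump-≤ (φ σ) e 0≤g uniq)
        (≤-trans (+-monoˡ-≤ g (+-monoˡ-≤ g (half inv uniq)))
          (≤-reflexive (solve 2 (λ W g → W :+ W :+ g :+ g := W :+ g :+ (W :+ g)) refl (W' σ) g)))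
    }
    where
    g = gain (φ σ) e
    r = R inv
    0≤φ = φ-nonNeg (hist inv)
    0≤g = gain-nonNeg (φ σ) e 0≤φ acc
    -- The old potential x satisfies εx ≤ g by acceptance, and the bump raises it by exactly g
    -- because the endpoints differ; a loop would add 2g.
    endpoint-≤ : ∀ x {y} → 0ℚ ≤ y → ε * (x + y) ≤ g → ε * (x + g) ≤ (1ℚ + ε) * g
    endpoint-≤ x {y} 0≤y le = ≤-from-slack (ε * y + (g - ε * (x + y)))
      (solve 4 (λ e x y g → (con 1ℚ :+ e) :* g := e :* (x :+ g) :+ (e :* y :+ (g :- e :* (x :+ y)))) refl ε x y g)
      (0≤+ (0≤* 0≤ε 0≤y) (0≤- le))
    trim-u = trim-loss (u e) (keep e acc (hist inv)) 0≤g
      (≤-trans (≤-reflexive (cong (ε *_) (bump-at-u (φ σ) e g u≢v))) (endpoint-≤ (φ σ (u e)) (0≤φ (v e)) (gain-≥ (φ σ) e acc)))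
    R₁ = proj₁ trim-u
    trim-v = trim-loss (v e) (proj₁ (proj₂ trim-u)) 0≤g
      (≤-trans (≤-reflexive (cong (ε *_) (bump-at-v (φ σ) e g u≢v))) (endpoint-≤ (φ σ (v e)) (0≤φ (u e))
        (≤-trans (≤-reflexive (cong (ε *_) (+-comm (φ σ (v e)) (φ σ (u e))))) (gain-≥ (φ σ) e acc))))
    R₂ = proj₁ trim-v

  init-invariant : Invariant [] initState
  init-invariant = record
    { full-hist = start
    ; full-⊆    = []
    ; hist      = start
    ; retained  = ≤-reflexive (*-zeroʳ (1ℚ - (+ 2 / 1) * ε))
    ; stack-⊆   = []
    ; bounded   = λ _ → refl
    ; covered   = []
    ; half      = λ {xs} _ → total-zero xs
    }
    where
    total-zero : ∀ xs → total (λ _ → 0ℚ) xs ≤ 0ℚ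
    total-zero []       = ≤-refl
    total-zero (_ ∷ xs) = +-monoʳ-≤ 0ℚ (total-zero xs)

  run-invariant : ∀ {S seen σ} → All NoLoop S → Invariant seen σ → Invariant (S ʳ++ seen) (run ε σ S)
  run-invariant []           inv = inv
  run-invariant (u≢v ∷ ok) inv = run-invariant ok (step-invariant _ u≢v inv)

  stream-invariant : ∀ {S} → All NoLoop S → Invariant (reverse S) (run ε initState S)
  stream-invariant ok = run-invariant ok init-invariant

  -- Growth of potentials and reduced weight along a run.

  record _≼_ (σ τ : AlgState) : Set where
    field
      φ-≤ : ∀ x → φ σ x ≤ φ τ x
      W-≤ : W' σ ≤ W' τ
  open _≼_

  step-≼ : ∀ {seen σ} e → Invariant seen σ → σ ≼ step ε σ e
  step-≼ {σ = σ} e inv with step ε σ e | step-view σ e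
  ... | _ | reject _   = record { φ-≤ = λ _ → ≤-refl ; W-≤ = ≤-refl }
  ... | _ | accept acc = record
    { φ-≤ = λ x → bump-≥ (φ σ) e x 0≤g
    ; W-≤ = ≤-from-slack (gain (φ σ) e) refl 0≤g
    }
    where 0≤g = gain-nonNeg (φ σ) e (φ-nonNeg (hist inv)) acc

  run-≼ : ∀ {S seen σ} → All NoLoop S → Invariant seen σ → σ ≼ run ε σ S
  run-≼ []                     inv = record { φ-≤ = λ _ → ≤-refl ; W-≤ = ≤-refl }
  run-≼ {e ∷ S} (u≢v ∷ ok) inv = record
    { φ-≤ = λ x → ≤-trans (φ-≤ first x) (φ-≤ rest x)
    ; W-≤ = ≤-trans (W-≤ first) (W-≤ rest)
    }
    where
    first = step-≼ e inv
    rest  = run-≼ ok (step-invariant e u≢v inv)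

  run-++ : ∀ σ S T → run ε σ (S ++ T) ≡ run ε (run ε σ S) T
  run-++ σ []      T = refl
  run-++ σ (e ∷ S) T = run-++ (step ε σ e) S T

  -- Bounding matchings by potentials.

  weight-covered : ∀ {φ M} → All (Covered φ) M → weight M ≤ (1ℚ + ε) * total φ (vertices M)
  weight-covered [] = ≤-reflexive (sym (*-zeroʳ (1ℚ + ε)))
  weight-covered {φ} {e ∷ M} (c ∷ cs) = ≤-trans (+-mono-≤ c (weight-covered cs))
    (≤-reflexive (solve 4 (λ e a b t → (con 1ℚ :+ e) :* (a :+ b) :+ (con 1ℚ :+ e) :* t := (con 1ℚ :+ e) :* (a :+ (b :+ t)))
      refl ε (φ (u e)) (φ (v e)) (total φ (vertices M))))

  covered-stream : ∀ {S} → All NoLoop S → All (Covered (φ (run ε initState S))) S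
  covered-stream {S} ok = All-resp-↭ (↭-reverse S) (covered (stream-invariant ok))

  total-≤-2W : ∀ {S M} → All NoLoop S → All NoLoop M → AllPairs Disjoint M →
    total (φ (run ε initState S)) (vertices M) ≤ W'[ ε ] S + W'[ ε ] S
  total-≤-2W ok okM dss = half (stream-invariant ok) (vertices-unique okM dss)

  -- M need not be ordered as in S, unlike the matchings in MWM: prefix-bound puts edges of B before those of A.
  matching-≤ : ∀ {S M} → All NoLoop S → All NoLoop M → All (Covered (φ (run ε initState S))) M → AllPairs Disjoint M →
    weight M ≤ ((+ 2 / 1) + (+ 2 / 1) * ε) * W'[ ε ] S
  matching-≤ {S} {M} ok okM cov dss = begin
    weight M                                                ≤⟨ weight-covered cov ⟩
    (1ℚ + ε) * total (φ (run ε initState S)) (vertices M)   ≤⟨ *-monoˡ-≤-nonNeg (1ℚ + ε) {{nonNegative (0≤+ (nonNegative⁻¹ 1ℚ) 0≤ε)}} (total-≤-2W ok okM dss) ⟩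
    (1ℚ + ε) * (W'[ ε ] S + W'[ ε ] S)                      ≡⟨ solve 2 (λ e W → (con 1ℚ :+ e) :* (W :+ W) := (con (+ 2 / 1) :+ con (+ 2 / 1) :* e) :* W) refl ε (W'[ ε ] S) ⟩
    ((+ 2 / 1) + (+ 2 / 1) * ε) * W'[ ε ] S                 ∎
    where open ≤-Reasoning

  unwind-in-stream : ∀ {st S} → st ⊆ reverse S → IsMatchingIn S (unwind [] st)
  unwind-in-stream {st} {S} sub =
    ⊆-trans (unwind-⊆ [] st) (subst (reverse st ⊆_) (List.reverse-involutive S) (reverse⁺ sub)) , unwind-matching st []

  W-nonNeg : ∀ {S} → All NoLoop S → 0ℚ ≤ W'[ ε ] S
  W-nonNeg ok = R-nonNeg (full-hist (stream-invariant ok))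

  -- The witness unwinds the virtual stack `full`, which loses nothing to evictions; the actual
  -- stack would guarantee only (1 - 2ε)W'.
  W-≤MWM : ∀ {S} → All NoLoop S → W'[ ε ] S ≤MWM S
  W-≤MWM {S} ok = unwind [] (full inv) , unwind-in-stream (full-⊆ inv) ,
    subst₂ _≤_ (+-identityˡ _) (+-identityʳ _) (unwind-bound (full-hist inv) [])
    where inv = stream-invariant ok

  MWM-≤ : ∀ {S} → All NoLoop S → MWM S ≤ ((+ 2 / 1) + (+ 2 / 1) * ε) * W'[ ε ] S
  MWM-≤ ok M (M⊆S , dss) = matching-≤ ok (All-resp-⊆ M⊆S ok) (All-resp-⊆ M⊆S (covered-stream ok)) dss

  retained-≤-M̂ : ∀ {S} → All NoLoop S → (1ℚ - (+ 2 / 1) * ε) * W'[ ε ] S ≤ weight (M̂[ ε ] S)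
  retained-≤-M̂ ok = ≤-trans (retained inv) (subst₂ _≤_ (+-identityˡ _) (+-identityʳ _) (unwind-bound (hist inv) []))
    where inv = stream-invariant ok

  -- A matching of A, extended greedily by the edges stacked during B, is a matching of AB.
  prefix-bound : ∀ {A B M} → All NoLoop (A ++ B) → IsMatchingIn A M →
    weight M + W'[ ε ] B ≤ ((+ 2 / 1) + (+ 2 / 1) * ε) * W'[ ε ] (A ++ B) + total (φ (run ε initState B)) (vertices M)
  prefix-bound {A} {B} {M} ok (M⊆A , dss) = ≤-trans (unwind-bound (full-hist inv) M)
    (+-monoˡ-≤ (total (φ (run ε initState B)) (vertices M))
      -- The unwound edges come from A and B alike, so they are measured against the potentials of
      -- the run on AB, which cover both.
      (matching-≤ ok (unwound ok) (unwound (covered-stream ok)) (unwind-matching (full inv) dss)))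
    where
    inv = stream-invariant (AllP.++⁻ʳ A ok)
    unwound : ∀ {P : Edge → Set} → All P (A ++ B) → All P (unwind M (full inv))
    unwound ps = unwind-All (All-resp-⊆ (full-⊆ inv) (All-resp-↭ (↭-sym (↭-reverse B)) (AllP.++⁻ʳ A ps)))
                            (All-resp-⊆ M⊆A (AllP.++⁻ˡ A ps))

  -- The second output compared with the whole stream ABC.

  M̂-≤MWM : ∀ A {S} → All NoLoop (A ++ S) → weight (M̂[ ε ] S) ≤MWM (A ++ S)
  M̂-≤MWM A ok with unwind-in-stream (stack-⊆ (stream-invariant (AllP.++⁻ʳ A ok)))
  ... | sub , dss = _ , (++⁺ˡ A sub , dss) , ≤-refl

  window-loss : ∀ {β WA WB} → β ≤ ε * (+ 1 / 9) → 0ℚ ≤ WA → (1ℚ - β) * WA ≤ WB →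
    ((+ 2 / 1) + (+ 2 / 1) * ε) * WA ≤ ((+ 2 / 1) + (+ 3 / 1) * ε) * WB
  window-loss {β} {WA} {WB} β≤ 0≤WA hyp = ≤-from-slack
    -- At β = ε/9 one has (2 + 3ε)(1 - β) - (2 + 2ε) = ε(7/9 - ε/3), and 67/90 is the value of 7/9 -
    -- ε/3 at ε = 1/10.
    (k * (WB - (1ℚ - β) * WA) + (k * ((ε * (+ 1 / 9) - β) * WA) + ε * ((⅒ - ε) * (+ 1 / 3) + + 67 / 90) * WA))
    (solve 4 (λ e b x y →
        (con (+ 2 / 1) :+ con (+ 3 / 1) :* e) :* y :=
        (con (+ 2 / 1) :+ con (+ 2 / 1) :* e) :* x :+
          ((con (+ 2 / 1) :+ con (+ 3 / 1) :* e) :* (y :- (con 1ℚ :- b) :* x) :+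
          ((con (+ 2 / 1) :+ con (+ 3 / 1) :* e) :* ((e :* con (+ 1 / 9) :- b) :* x) :+
           e :* ((con ⅒ :- e) :* con (+ 1 / 3) :+ con (+ 67 / 90)) :* x)))
      refl ε β WA WB)
    (0≤+ (0≤* 0≤k (0≤- hyp)) (0≤+ (0≤* 0≤k (0≤* (0≤- β≤) 0≤WA))
      (0≤* (0≤* 0≤ε (0≤+ (0≤* (0≤- ε≤⅒) (nonNegative⁻¹ (+ 1 / 3))) (nonNegative⁻¹ (+ 67 / 90)))) 0≤WA)))
    where
    ⅒ = + 1 / 10
    k = (+ 2 / 1) + (+ 3 / 1) * ε
    0≤k : 0ℚ ≤ k
    0≤k = 0≤+ (nonNegative⁻¹ (+ 2 / 1)) (0≤* (nonNegative⁻¹ (+ 3 / 1)) 0≤ε)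

  -- (3 + 20ε)(1 - 2ε) exceeds 3 + 5ε by ε(9 - 40ε), where 9 - 40ε = 40(1/10 - ε) + 5.
  trim-slack : ∀ {W m} → 0ℚ ≤ W → (1ℚ - (+ 2 / 1) * ε) * W ≤ m →
    ((+ 3 / 1) + (+ 5 / 1) * ε) * W ≤ ((+ 3 / 1) + (+ 20 / 1) * ε) * m
  trim-slack {W} {m} 0≤W hyp = ≤-from-slack
    (((+ 3 / 1) + (+ 20 / 1) * ε) * (m - (1ℚ - (+ 2 / 1) * ε) * W) + ε * ((+ 40 / 1) * (⅒ - ε) + + 5 / 1) * W)
    (solve 3 (λ e W m →
        (con (+ 3 / 1) :+ con (+ 20 / 1) :* e) :* m :=
        (con (+ 3 / 1) :+ con (+ 5 / 1) :* e) :* W :+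
          ((con (+ 3 / 1) :+ con (+ 20 / 1) :* e) :* (m :- (con 1ℚ :- con (+ 2 / 1) :* e) :* W) :+
           e :* (con (+ 40 / 1) :* (con ⅒ :- e) :+ con (+ 5 / 1)) :* W))
      refl ε W m)
    (0≤+ (0≤* (0≤+ (nonNegative⁻¹ (+ 3 / 1)) (0≤* (nonNegative⁻¹ (+ 20 / 1)) 0≤ε)) (0≤- hyp))
      (0≤* (0≤* 0≤ε (0≤+ (0≤* (nonNegative⁻¹ (+ 40 / 1)) (0≤- ε≤⅒)) (nonNegative⁻¹ (+ 5 / 1)))) 0≤W))
    where ⅒ = + 1 / 10

  -- Here T₁ and T₁′ are the potentials of B and of BC on the part of the matching in A, and T₂
  -- those of BC on the rest. Then w₁ ≤ (1 + 3ε)WB + T₁′ and w₂ ≤ (1 + ε)T₂. Raising the coefficient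
  -- of T₁′ to 1 + ε, the two potential terms total at most (1 + ε)2W, hence 1 + 3ε + 2 + 2ε = 3 +
  -- 5ε.
  window-sum : ∀ {w₁ w₂ y WB W T₁ T₁′ T₂} →
    w₁ + WB ≤ y + T₁ → y ≤ ((+ 2 / 1) + (+ 3 / 1) * ε) * WB → w₂ ≤ (1ℚ + ε) * T₂ →
    T₁ ≤ T₁′ → 0ℚ ≤ T₁′ → T₁′ + T₂ ≤ W + W → WB ≤ W →
    w₁ + w₂ ≤ ((+ 3 / 1) + (+ 5 / 1) * ε) * W
  window-sum {w₁} {w₂} {y} {WB} {W} {T₁} {T₁′} {T₂} h₁ hy h₂ hT 0≤T₁′ hW hB = ≤-from-slack
    (((y + T₁) - (w₁ + WB)) + (((+ 2 / 1) + (+ 3 / 1) * ε) * WB - y) + ((1ℚ + ε) * T₂ - w₂) + (T₁′ - T₁) + ε * T₁′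
      + (1ℚ + ε) * ((W + W) - (T₁′ + T₂)) + (1ℚ + (+ 3 / 1) * ε) * (W - WB))
    (solve 9 (λ e w₁ w₂ y WB W T₁ T₁′ T₂ →
        (con (+ 3 / 1) :+ con (+ 5 / 1) :* e) :* W :=
        w₁ :+ w₂ :+
          (((y :+ T₁) :- (w₁ :+ WB)) :+ ((con (+ 2 / 1) :+ con (+ 3 / 1) :* e) :* WB :- y) :+ ((con 1ℚ :+ e) :* T₂ :- w₂) :+ (T₁′ :- T₁) :+ e :* T₁′
            :+ (con 1ℚ :+ e) :* ((W :+ W) :- (T₁′ :+ T₂)) :+ (con 1ℚ :+ con (+ 3 / 1) :* e) :* (W :- WB)))
      refl ε w₁ w₂ y WB W T₁ T₁′ T₂)
    (0≤+ (0≤+ (0≤+ (0≤+ (0≤+ (0≤+ (0≤- h₁) (0≤- hy)) (0≤- h₂)) (0≤- hT)) (0≤* 0≤ε 0≤T₁′))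
      (0≤* (0≤+ (nonNegative⁻¹ 1ℚ) 0≤ε) (0≤- hW)))
      (0≤* (0≤+ (nonNegative⁻¹ 1ℚ) (0≤* (nonNegative⁻¹ (+ 3 / 1)) 0≤ε)) (0≤- hB)))

  -- The run on BC never sees edges of A, so its potentials need not cover `M₁`. That part is paid
  -- for by `prefix-bound`, where the hypothesis on W' lets AB be replaced by B; `M₂` is covered
  -- directly.
  lookahead-≤ : ∀ {β} A B C → All NoLoop (A ++ B ++ C) → β ≤ ε * (+ 1 / 9) →
    (1ℚ - β) * W'[ ε ] (A ++ B) ≤ W'[ ε ] B →
    MWM (A ++ B ++ C) ≤ ((+ 3 / 1) + (+ 20 / 1) * ε) * weight (M̂[ ε ] (B ++ C))
  lookahead-≤ A B C ok β≤ hyp M (M⊆ , dss) with ⊆-++⁻ A M⊆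
  ... | M₁ , M₂ , refl , M₁⊆A , M₂⊆BC = begin
    weight (M₁ ++ M₂)                                         ≡⟨ weight-++ M₁ M₂ ⟩
    weight M₁ + weight M₂
      ≤⟨ window-sum {weight M₁} (prefix-bound okAB (M₁⊆A , AllPairs-++⁻ˡ M₁ dss)) (window-loss β≤ (W-nonNeg okAB) hyp)
           (weight-covered (All-resp-⊆ M₂⊆BC (covered-stream okBC)))
           (total-mono (φ-≤ B≼BC) (vertices M₁)) (total-nonNeg 0≤φ (vertices M₁))
           -- Both parts come from one matching, so their vertices are distinct and share the single
           -- budget 2W' of the run on BC.
           (≤-trans (≤-reflexive (sym (total-++ (φ (run ε initState (B ++ C))) M₁ M₂))) (total-≤-2W okBC (All-resp-⊆ M⊆ ok) dss))
           (W-≤ B≼BC) ⟩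
    ((+ 3 / 1) + (+ 5 / 1) * ε) * W'[ ε ] (B ++ C)            ≤⟨ trim-slack (W-nonNeg okBC) (retained-≤-M̂ okBC) ⟩
    ((+ 3 / 1) + (+ 20 / 1) * ε) * weight (M̂[ ε ] (B ++ C))  ∎
    where
    open ≤-Reasoning
    okBC = AllP.++⁻ʳ A ok
    okB  = AllP.++⁻ˡ B okBC
    okAB = AllP.++⁺ (AllP.++⁻ˡ A ok) okB
    B≼BC : run ε initState B ≼ run ε initState (B ++ C)
    -- The run on BC passes through the final state of the run on B.
    B≼BC = subst (run ε initState B ≼_) (sym (run-++ initState B C)) (run-≼ (AllP.++⁻ʳ B okBC) (stream-invariant okB))
    0≤φ = φ-nonNeg (hist (stream-invariant okBC))

theorem8 : (ε β : ℚ) → 0ℚ < ε → ε ≤ + 1 / 10 → 0ℚ < β → β ≤ ε * (+ 1 / 9) →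
    ((S : List Edge) → ValidStream S →
    (W'[ ε ] S ≤MWM S) × (MWM S ≤ ((+ 2 / 1) + (+ 2 / 1) * ε) * W'[ ε ] S))
    × ((A B C : List Edge) → ValidStream (A ++ B ++ C) →
    (1ℚ - β) * W'[ ε ] (A ++ B) ≤ W'[ ε ] B →
    (weight (M̂[ ε ] (B ++ C)) ≤MWM (A ++ B ++ C))
    × (MWM (A ++ B ++ C) ≤ ((+ 3 / 1) + (+ 20 / 1) * ε) * weight (M̂[ ε ] (B ++ C))))
theorem8 ε β 0<ε ε≤⅒ _ β≤ =
  (λ S valid → W-≤MWM (noLoops valid) , MWM-≤ (noLoops valid)) ,
  λ A B C valid hyp → M̂-≤MWM A (noLoops valid) , lookahead-≤ A B C (noLoops valid) β≤ hyp
  where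
  open Analysis ε 0<ε ε≤⅒
  noLoops : ∀ {S} → ValidStream S → All NoLoop S
  noLoops = All.map proj₁
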